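{- Let $G=(V,E)$ be a finite simple connected graph with an edge $e=uv$. Then $\beth^{2}(G/e)\le \beth^{2}(G)$.
   Context: All graphs are finite and simple. For an edge $e=uv$, $G/e$ is the simple graph obtained by contracting $e$: the vertices $u,v$ are replaced by a single vertex $v_e$ adjacent to exactly those other vertices that are adjacent to $u$ or $v$ in $G$ (no loops or multiple edges are created). $C(G)$ denotes the set of all induced cycles in $G$ (of length at least 3). The second graph characteristic is $\beth^{2}(G)=|C(G)|-|E(G)|+|V(G)|$. -}

module Defs where

open import Data.Bool.Base using (true; false)
open import Data.Empty using (⊥)
open import Data.Fin.Base using (Fin; zero; suc; toℕ; punchIn; punchOut; fromℕ<)
open import Data.Fin.Properties using (_≟_; _<?_; any?; all?; toℕ-fromℕ<; injective⇒≤)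
open import Data.Fin.Subset using (Subset; _∈_)
open import Data.Fin.Subset.Properties using (_∈?_)
open import Data.Integer.Base as ℤ using (ℤ)
open import Data.List.Base as List using (List; length; filter; cartesianProduct; allFin; _++_)
open import Data.Nat.Base as ℕ using (ℕ; zero; suc; pred; _+_; _%_)
import Data.Nat.Properties as ℕ
open import Data.Product.Base using (_×_; _,_; ∃)
open import Data.Sum.Base using (_⊎_)
open import Data.Vec.Base as Vec using (Vec; []; _∷_; lookup; tabulate)
open import Data.Vec.Properties using (lookup∘tabulate)
open import Function.Bundles using (_⇔_; mk⇔; module Equivalence)
open import Function.Definitions using (Injective)
open import Level using (0ℓ)
open import Relation.Binary.Construct.Closure.ReflexiveTransitive using (Star)
open import Relation.Binary.Core using (Rel)
open import Relation.Binary.Definitions using (Decidable; Symmetric)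
open import Relation.Binary.PropositionalEquality
  using (_≡_; _≢_; _≗_; refl; sym; trans; subst)
open import Relation.Nullary.Decidable
  using (Dec; yes; no; map′; _×-dec_; _⊎-dec_; _→-dec_)
open import Relation.Nullary.Negation using (¬_; contradiction)

private
  variable
    n : ℕ

record Graph (n : ℕ) : Set₁ where
  field
    Adj        : Rel (Fin n) 0ℓ
    adj?       : Decidable Adj
    adj-sym    : Symmetric Adj
    adj-irrefl : ∀ {x} → ¬ Adj x x

  adj⇒≢ : ∀ {x y} → Adj x y → x ≢ y
  adj⇒≢ x~x refl = adj-irrefl x~x

open Graph public

Connected : Graph n → Set
Connected G = ∀ x y → Star (Adj G) x y

-- Each unordered edge is listed once, with its smaller endpoint first.
edges : Graph n → List (Fin n × Fin n)
edges G = filter (λ (x , y) → (x <? y) ×-dec adj? G x y)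
                 (cartesianProduct (allFin _) (allFin _))

-- Enumerates the vertices of Fin (2 + n) different from u and v.
others : {u v : Fin (2 + n)} → u ≢ v → Fin n → Fin (2 + n)
others {u = u} u≢v i = punchIn u (punchIn (punchOut u≢v) i)

-- In G / e the vertex  zero  is the merged vertex, and  suc i  is the old
-- vertex  others u≢v i.
ContractAdj : (G : Graph (2 + n)) {u v : Fin (2 + n)} → u ≢ v → Rel (Fin (1 + n)) 0ℓ
ContractAdj G             u≢v zero    zero    = ⊥
ContractAdj G {u = u} {v} u≢v zero    (suc j) = Adj G u (others u≢v j) ⊎ Adj G v (others u≢v j)
ContractAdj G {u = u} {v} u≢v (suc i) zero    = Adj G u (others u≢v i) ⊎ Adj G v (others u≢v i)
ContractAdj G             u≢v (suc i) (suc j) = Adj G (others u≢v i) (others u≢v j)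

contract : (G : Graph (2 + n)) {u v : Fin (2 + n)} → u ≢ v → Graph (1 + n)
contract G {u} {v} u≢v = record
  { Adj = ContractAdj G u≢v ; adj? = dec ; adj-sym = λ {x} {y} → symm x y
  ; adj-irrefl = λ {x} → irr x }
  where
  dec : Decidable (ContractAdj G u≢v)
  dec zero    zero    = no λ ()
  dec zero    (suc j) = adj? G u (others u≢v j) ⊎-dec adj? G v (others u≢v j)
  dec (suc i) zero    = adj? G u (others u≢v i) ⊎-dec adj? G v (others u≢v i)
  dec (suc i) (suc j) = adj? G (others u≢v i) (others u≢v j)

  symm : ∀ x y → ContractAdj G u≢v x y → ContractAdj G u≢v y x
  symm zero    (suc j) p = p
  symm (suc i) zero    p = p
  symm (suc i) (suc j) p = adj-sym G p

  irr : ∀ x → ¬ ContractAdj G u≢v x x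
  irr (suc i) p = adj-irrefl G p

-- A graph with an edge has at least two vertices, so only the last clause matters.
infixl 7 _/_
_/_ : (G : Graph n) {u v : Fin n} → Adj G u v → Graph (pred n)
_/_ {n = suc zero}    G {zero} {zero} e = contradiction e (adj-irrefl G)
_/_ {n = suc (suc _)} G               e = contract G (adj⇒≢ G e)

-- j follows i in the cyclic order 0, 1, …, k + 2, 0.
Next : ∀ {k} → Rel (Fin (3 + k)) 0ℓ
Next {k} i j = toℕ j ≡ suc (toℕ i) % (3 + k)

CycleAdj : ∀ {k} → Rel (Fin (3 + k)) 0ℓ
CycleAdj i j = Next i j ⊎ Next j i

-- c is an isomorphism from the cycle on 3 + k vertices to the subgraph of G induced by S.
record IsInducedCycleOn (G : Graph n) (S : Subset n) {k} (c : Fin (3 + k) → Fin n) : Set where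
  field
    injective : Injective _≡_ _≡_ c
    image     : ∀ x → x ∈ S ⇔ ∃ λ i → c i ≡ x
    adjacent  : ∀ i j → CycleAdj i j ⇔ Adj G (c i) (c j)

-- An induced cycle is determined by its vertex set, so C(G) is represented by vertex sets.
IsInducedCycle : Graph n → Subset n → Set
IsInducedCycle {n} G S = ∃ λ k → ∃ λ (c : Fin (3 + k) → Fin n) → IsInducedCycleOn G S c

private
  ⇔-dec : {A B : Set} → Dec A → Dec B → Dec (A ⇔ B)
  ⇔-dec a? b? = map′ (λ (f , g) → mk⇔ f g)
                     (λ e → Equivalence.to e , Equivalence.from e)
                     ((a? →-dec b?) ×-dec (b? →-dec a?))

  anyVec? : ∀ m {P : Vec (Fin n) m → Set} → (∀ xs → Dec (P xs)) → Dec (∃ P)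
  anyVec? zero    P? = map′ ([] ,_) (λ { ([] , p) → p }) (P? [])
  anyVec? (suc m) P? = map′ (λ (x , xs , p) → (x ∷ xs) , p)
                            (λ { (x ∷ xs , p) → x , xs , p })
                            (any? λ x → anyVec? m λ xs → P? (x ∷ xs))

isInducedCycleOn? : (G : Graph n) (S : Subset n) → ∀ {k} (c : Fin (3 + k) → Fin n) →
                    Dec (IsInducedCycleOn G S c)
isInducedCycleOn? G S {k} c = map′
  (λ (inj , im , ad) → record
    { injective = λ {i} {j} → inj i j ; image = im ; adjacent = ad })
  (λ r → let open IsInducedCycleOn r in (λ i j → injective) , image , adjacent)
  (     all? (λ i → all? λ j → (c i ≟ c j) →-dec (i ≟ j))
  ×-dec all? (λ x → ⇔-dec (x ∈? S) (any? λ i → c i ≟ x))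
  ×-dec all? (λ i → all? λ j → ⇔-dec (cycleAdj? i j) (adj? G (c i) (c j))))
  where
  cycleAdj? : Decidable (CycleAdj {k})
  cycleAdj? i j = (toℕ j ℕ.≟ suc (toℕ i) % (3 + k)) ⊎-dec (toℕ i ℕ.≟ suc (toℕ j) % (3 + k))

private
  respects : (G : Graph n) (S : Subset n) → ∀ {k} {c d : Fin (3 + k) → Fin n} → c ≗ d →
             IsInducedCycleOn G S c → IsInducedCycleOn G S d
  respects G S c≗d r = record
    { injective = λ {i} {j} di≡dj → injective (trans (c≗d i) (trans di≡dj (sym (c≗d j))))
    ; image     = λ x → let module E = Equivalence (image x) in mk⇔
        (λ x∈S → let (i , ci≡x) = E.to x∈S in i , trans (sym (c≗d i)) ci≡x)
        (λ (i , di≡x) → E.from (i , trans (c≗d i) di≡x))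
    ; adjacent  = λ i j → subst (λ z → CycleAdj i j ⇔ Adj G z _) (c≗d i)
        (subst (λ z → CycleAdj i j ⇔ Adj G _ z) (c≗d j) (adjacent i j))
    }
    where open IsInducedCycleOn r

isInducedCycle? : (G : Graph n) (S : Subset n) → Dec (IsInducedCycle G S)
isInducedCycle? {n} G S = map′ sound complete
  (any? λ (k : Fin n) → anyVec? (3 + toℕ k) λ v → isInducedCycleOn? G S (lookup v))
  where
  sound : (∃ λ (k : Fin n) → ∃ λ v → IsInducedCycleOn G S {toℕ k} (lookup v)) →
          IsInducedCycle G S
  sound (k , v , r) = toℕ k , lookup v , r

  complete : IsInducedCycle G S →
             ∃ λ (k : Fin n) → ∃ λ v → IsInducedCycleOn G S {toℕ k} (lookup v)
  complete (k , c , r) = fromℕ< k<n ,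
    subst (λ m → ∃ λ v → IsInducedCycleOn G S {m} (lookup v)) (sym (toℕ-fromℕ< k<n))
      (tabulate c , respects G S (λ i → sym (lookup∘tabulate c i)) r)
    where
    k<n : k ℕ.< n
    k<n = ℕ.≤-trans (ℕ.m≤n+m (suc k) 2) (injective⇒≤ (IsInducedCycleOn.injective r))

allSubsets : ∀ n → List (Subset n)
allSubsets zero    = [] List.∷ List.[]
allSubsets (suc n) = List.map (true ∷_) (allSubsets n) ++ List.map (false ∷_) (allSubsets n)

inducedCycles : Graph n → List (Subset n)
inducedCycles G = filter (isInducedCycle? G) (allSubsets _)

ℶ² : Graph n → ℤ
ℶ² {n} G = ℤ.+ length (inducedCycles G) ℤ.- ℤ.+ length (edges G) ℤ.+ ℤ.+ n

{-# OPTIONS --safe #-}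
module Submission where

-- Let t be the number of common neighbours of u and v.  Contracting e loses at most 1 + t
-- edges and exactly one vertex, so it suffices to find t more induced cycles in G than in
-- G / e.  The t triangles on e are induced cycles of G.  Every induced cycle of G / e lifts
-- to an induced cycle of G which is not one of them: if it avoids the merged vertex, it is
-- a cycle of G already; otherwise the merged vertex has two neighbours on the cycle, and it
-- is replaced by u if u is adjacent to both, by v if v is adjacent to both, and by the edge
-- uv if each of u and v is adjacent to just one of them.  Contracting the vertex set of a
-- lift gives back the vertex set of the cycle, so lifting is injective.

open import Defs
open import Data.Bool.Base using (true; false)
open import Data.Fin.Base as Fin using (Fin; zero; suc; punchIn; punchOut; fromℕ; inject₁)
open import Data.Fin.Induction using (>-weakInduction)
open import Data.Fin.Properties
  using (_≟_; _<?_; any?; <-cmp; toℕ-injective; toℕ-fromℕ; toℕ-inject₁; toℕ<n;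
         punchIn-injective; punchInᵢ≢i; punchIn-punchOut;
         inject₁-injective; fromℕ≢inject₁; suc-injective; injective⇒≤)
open import Data.Fin.Relation.Unary.Top using (view; ‵fromℕ; ‵inject₁)
open import Data.Fin.Subset using (Subset; _∈_)
open import Data.Fin.Subset.Properties using (⊆-antisym)
open import Data.Integer.Base as ℤ using (_≤_)
import Data.Integer.Properties as ℤ
open import Data.Integer.Tactic.RingSolver using (solve-∀)
open import Data.List.Base as List using (List; _∷_; []; _++_; length; filter; allFin; cartesianProduct)
import Data.List.Properties as List
open import Data.List.Membership.Propositional renaming (_∈_ to _∈ˡ_)
open import Data.List.Membership.Propositional.Properties
  using (∈-map⁺; ∈-map⁻; ∈-++⁺ˡ; ∈-++⁺ʳ; ∈-++⁻; ∈-cartesianProduct⁺;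
         ∈-filter⁺; ∈-filter⁻; ∈-lookup; ∈-allFin)
open import Data.List.Relation.Binary.Disjoint.Propositional using (Disjoint)
import Data.List.Relation.Unary.All as All
open import Data.List.Relation.Unary.AllPairs using (_∷_; [])
open import Data.List.Relation.Unary.Any using (here; there; index)
open import Data.List.Relation.Unary.Any.Properties using (lookup-index)
open import Data.List.Relation.Unary.Unique.Propositional using (Unique)
import Data.List.Relation.Unary.Unique.Propositional.Properties as Unique
open import Data.Nat.Base as ℕ using (ℕ; zero; suc; _+_; _%_; s≤s)
import Data.Nat.DivMod as ℕ
import Data.Nat.Properties as ℕ
open import Data.Product.Base using (_×_; _,_; ∃; proj₁; proj₂)
open import Data.Sum.Base as Sum using (_⊎_; inj₁; inj₂; [_,_]′; swap)
open import Data.Sum.Properties using (inj₁-injective; inj₂-injective)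
open import Data.Vec.Base as Vec using ()
import Data.Vec.Functional as Vector
open import Data.Vec.Properties using (lookup∘tabulate; []=⇒lookup; lookup⇒[]=; ∷-injectiveʳ)
open import Function.Base using (_∘_; id)
open import Function.Bundles using (_⇔_; mk⇔; module Equivalence)
open import Function.Definitions using (Injective)
open import Relation.Binary.Definitions using (tri<; tri≈; tri>)
open import Relation.Binary.Core using (Rel)
open import Relation.Binary.PropositionalEquality
  using (_≡_; _≢_; refl; sym; trans; cong; cong₂; subst; subst₂)
open import Relation.Nullary.Decidable using (Dec; yes; no; does; _×-dec_; dec-true)
open import Relation.Nullary.Negation using (¬_; contradiction)

open Equivalence using (to; from)

private
  variable
    A B C : Set
    n k : ℕ

-- Comparing lengths of duplicate-free lists

lookup-injective : {xs : List A} → Unique xs → Injective _≡_ _≡_ (List.lookup xs)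
lookup-injective (_ ∷ _)   {zero}  {zero}  _  = refl
lookup-injective (x∉ ∷ _)  {zero}  {suc j} eq = contradiction eq (All.lookup x∉ (∈-lookup j))
lookup-injective (x∉ ∷ _)  {suc i} {zero}  eq = contradiction (sym eq) (All.lookup x∉ (∈-lookup i))
lookup-injective (_ ∷ xs!) {suc i} {suc j} eq = cong suc (lookup-injective xs! eq)

-- Choosing a related entry of `ys` for each position of `xs` gives a map between positions, and
-- injectivity of `R` makes it injective. A relation is used because a lift is found by case
-- analysis, while the cycle it comes from is recovered uniformly.
injectiveRelation⇒length≤ :
  {xs : List A} {ys : List B} → Unique xs → (R : A → B → Set) →
  (∀ {x x′ y} → R x y → R x′ y → x ≡ x′) →
  (∀ {x} → x ∈ˡ xs → ∃ λ y → y ∈ˡ ys × R x y) →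
  length xs ℕ.≤ length ys
injectiveRelation⇒length≤ {xs = xs} {ys} xs! R injective total = injective⇒≤ position-injective
  where
  position : Fin (length xs) → Fin (length ys)
  position i = index (proj₁ (proj₂ (total (∈-lookup i))))

  related : ∀ i → R (List.lookup xs i) (List.lookup ys (position i))
  related i with total (∈-lookup {xs = xs} i)
  ... | _ , y∈ys , r = subst (R _) (lookup-index y∈ys) r

  position-injective : Injective _≡_ _≡_ position
  position-injective {i} {j} eq = lookup-injective xs!
    (injective (related i) (subst (R _) (cong (List.lookup ys) (sym eq)) (related j)))

-- The previous bound, applied to the tagged union of `xs` and `ys`. Incompatibility of `R` and `Q`
-- excludes a collision between the two tags.
disjointInjectiveRelations⇒length≤ :
  {xs : List A} {ys : List B} {zs : List C} → Unique xs → Unique ys →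
  (R : A → C → Set) → (Q : B → C → Set) →
  (∀ {x x′ z} → R x z → R x′ z → x ≡ x′) →
  (∀ {y y′ z} → Q y z → Q y′ z → y ≡ y′) →
  (∀ {x y z} → R x z → ¬ Q y z) →
  (∀ {x} → x ∈ˡ xs → ∃ λ z → z ∈ˡ zs × R x z) →
  (∀ {y} → y ∈ˡ ys → ∃ λ z → z ∈ˡ zs × Q y z) →
  length xs + length ys ℕ.≤ length zs
disjointInjectiveRelations⇒length≤ {A} {B} {C} {xs} {ys} {zs} xs! ys! R Q R-inj Q-inj R⇒¬Q R-total Q-total =
  subst (ℕ._≤ length zs) length-sum (injectiveRelation⇒length≤ sum-unique R∪Q R∪Q-injective R∪Q-total)
  where
  left right : List (A ⊎ B)
  left  = List.map inj₁ xs
  right = List.map inj₂ ys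

  length-sum : length (left ++ right) ≡ length xs + length ys
  length-sum = trans (List.length-++ left) (cong₂ _+_ (List.length-map inj₁ xs) (List.length-map inj₂ ys))

  disjoint : Disjoint left right
  disjoint (p , q) with ∈-map⁻ inj₁ p | ∈-map⁻ inj₂ q
  ... | _ , _ , refl | _ , _ , ()

  sum-unique : Unique (left ++ right)
  sum-unique = Unique.++⁺ (Unique.map⁺ inj₁-injective xs!) (Unique.map⁺ inj₂-injective ys!) disjoint

  R∪Q : A ⊎ B → C → Set
  R∪Q (inj₁ x) = R x
  R∪Q (inj₂ y) = Q y

  R∪Q-injective : ∀ {s s′ z} → R∪Q s z → R∪Q s′ z → s ≡ s′
  R∪Q-injective {inj₁ _} {inj₁ _} r r′ = cong inj₁ (R-inj r r′)
  R∪Q-injective {inj₁ _} {inj₂ _} r q  = contradiction q (R⇒¬Q r)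
  R∪Q-injective {inj₂ _} {inj₁ _} q r  = contradiction q (R⇒¬Q r)
  R∪Q-injective {inj₂ _} {inj₂ _} q q′ = cong inj₂ (Q-inj q q′)

  R∪Q-total : ∀ {s} → s ∈ˡ left ++ right → ∃ λ z → z ∈ˡ zs × R∪Q s z
  R∪Q-total s∈ with ∈-++⁻ left s∈
  ... | inj₁ s∈left with ∈-map⁻ inj₁ s∈left
  ...   | _ , x∈ , refl = R-total x∈
  R∪Q-total s∈ | inj₂ s∈right with ∈-map⁻ inj₂ s∈right
  ...   | _ , y∈ , refl = Q-total y∈

length-map-++-∷-map : (f : A → C) (z : C) (g : B → C) (xs : List A) (ys : List B) →
                      length (List.map f xs ++ z ∷ List.map g ys) ≡ length xs + suc (length ys)
length-map-++-∷-map f z g xs ys = trans (List.length-++ (List.map f xs))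
  (cong₂ (λ l l′ → l + suc l′) (List.length-map f xs) (List.length-map g ys))

⊆⇒length≤ : {xs ys : List A} → Unique xs → (∀ {x} → x ∈ˡ xs → x ∈ˡ ys) → length xs ℕ.≤ length ys
⊆⇒length≤ xs! xs⊆ys = injectiveRelation⇒length≤ xs! _≡_ (λ p q → trans p (sym q))
  λ x∈xs → _ , xs⊆ys x∈xs , refl

-- The enumerations of subsets, induced cycles and edges

allSubsets-complete : (S : Subset n) → S ∈ˡ allSubsets n
allSubsets-complete Vec.[]            = here refl
allSubsets-complete (true Vec.∷ S)  = ∈-++⁺ˡ (∈-map⁺ _ (allSubsets-complete S))
allSubsets-complete (false Vec.∷ S) = ∈-++⁺ʳ _ (∈-map⁺ _ (allSubsets-complete S))

allSubsets-unique : ∀ n → Unique (allSubsets n)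
allSubsets-unique zero    = All.[] ∷ []
allSubsets-unique (suc n) = Unique.++⁺
  (Unique.map⁺ ∷-injectiveʳ (allSubsets-unique n))
  (Unique.map⁺ ∷-injectiveʳ (allSubsets-unique n))
  λ (p , q) → disjoint (∈-map⁻ _ p) (∈-map⁻ _ q)
  where
  disjoint : ∀ {S} → (∃ λ T → T ∈ˡ allSubsets n × S ≡ true Vec.∷ T) →
             ¬ (∃ λ T → T ∈ˡ allSubsets n × S ≡ false Vec.∷ T)
  disjoint (_ , _ , refl) (_ , _ , ())

inducedCycles-unique : (G : Graph n) → Unique (inducedCycles G)
inducedCycles-unique G = Unique.filter⁺ (isInducedCycle? G) (allSubsets-unique _)

∈-inducedCycles⁺ : (G : Graph n) {S : Subset n} → IsInducedCycle G S → S ∈ˡ inducedCycles G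
∈-inducedCycles⁺ G = ∈-filter⁺ (isInducedCycle? G) (allSubsets-complete _)

∈-inducedCycles⁻ : (G : Graph n) {S : Subset n} → S ∈ˡ inducedCycles G → IsInducedCycle G S
∈-inducedCycles⁻ {n} G S∈ = proj₂ (∈-filter⁻ (isInducedCycle? G) {xs = allSubsets n} S∈)

edges-unique : (G : Graph n) → Unique (edges G)
edges-unique G = Unique.filter⁺ (λ (x , y) → (x <? y) ×-dec adj? G x y)
  (Unique.cartesianProduct⁺ (Unique.allFin⁺ _) (Unique.allFin⁺ _))

subset-ext : {S T : Subset n} → (∀ x → x ∈ S ⇔ x ∈ T) → S ≡ T
subset-ext S⇔T = ⊆-antisym (λ {x} → to (S⇔T x)) (λ {x} → from (S⇔T x))

range : {l : ℕ} → (Fin l → Fin n) → Subset n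
range f = Vec.tabulate λ x → does (any? λ i → f i ≟ x)

∈-range : {l : ℕ} (f : Fin l → Fin n) → ∀ x → x ∈ range f ⇔ ∃ λ i → f i ≡ x
∈-range f x = mk⇔
  (λ x∈ → extract (any? λ i → f i ≟ x) (trans (sym (lookup∘tabulate _ x)) ([]=⇒lookup x∈)))
  (λ x∈ → lookup⇒[]= x _ (trans (lookup∘tabulate _ x) (dec-true (any? λ i → f i ≟ x) x∈)))
  where
  extract : {P : Set} (P? : Dec P) → does P? ≡ true → P
  extract (yes p) _ = p

-- Cyclic order without remainders, and rotation of cycles

pred↻ : Fin (suc n) → Fin (suc n)
pred↻ zero    = fromℕ _
pred↻ (suc i) = inject₁ i

pred↻-injective : Injective _≡_ _≡_ (pred↻ {n})
pred↻-injective {x = zero}  {zero}  _  = refl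
pred↻-injective {x = zero}  {suc j} eq = contradiction eq fromℕ≢inject₁
pred↻-injective {x = suc i} {zero}  eq = contradiction (sym eq) fromℕ≢inject₁
pred↻-injective {x = suc i} {suc j} eq = cong suc (inject₁-injective eq)

pred↻-surjective : (i : Fin (suc n)) → ∃ λ j → pred↻ j ≡ i
pred↻-surjective i with view i
... | ‵fromℕ     = zero , refl
... | ‵inject₁ j = suc j , refl

-- On two successors this computes to the index condition of `IsPath`, so a path and the cycle
-- obtained from it by one more vertex share their adjacency proofs.
Adj↻ : Rel (Fin (suc n)) _
Adj↻ i j = i ≡ pred↻ j ⊎ j ≡ pred↻ i

next-pred↻ : (j : Fin (3 + k)) → Next (pred↻ j) j
next-pred↻ {k} zero    = sym (trans (cong (λ m → suc m % (3 + k)) (toℕ-fromℕ (2 + k))) (ℕ.n%n≡0 (3 + k)))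
next-pred↻ {k} (suc i) = sym (trans (cong (λ m → suc m % (3 + k)) (toℕ-inject₁ i))
  (ℕ.m<n⇒m%n≡m (s≤s (toℕ<n i))))

next⇔pred↻ : (i j : Fin (3 + k)) → Next i j ⇔ i ≡ pred↻ j
next⇔pred↻ i j = mk⇔ next⇒ λ { refl → next-pred↻ j }
  where
  next⇒ : Next i j → i ≡ pred↻ j
  next⇒ i→j with pred↻-surjective i
  -- Both `j` and `j′` are the remainder of the same number, hence equal.
  ... | j′ , refl = cong pred↻ (toℕ-injective (trans (next-pred↻ j′) (sym i→j)))

cycleAdj⇔adj↻ : (i j : Fin (3 + k)) → CycleAdj i j ⇔ Adj↻ i j
cycleAdj⇔adj↻ i j = mk⇔ (Sum.map (to (next⇔pred↻ i j)) (to (next⇔pred↻ j i)))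
                        (Sum.map (from (next⇔pred↻ i j)) (from (next⇔pred↻ j i)))

-- An induced cycle without its vertex set, which is recovered as the `range` of `c`.
record IsCycle (G : Graph n) (c : Fin (3 + k) → Fin n) : Set where
  field
    injective : Injective _≡_ _≡_ c
    adjacent  : ∀ i j → Adj↻ i j ⇔ Adj G (c i) (c j)

isInducedCycleOn⇒isCycle : {G : Graph n} {S : Subset n} {c : Fin (3 + k) → Fin n} →
                           IsInducedCycleOn G S c → IsCycle G c
isInducedCycleOn⇒isCycle r = record
  { injective = injective
  ; adjacent  = λ i j → let E = cycleAdj⇔adj↻ i j in
      mk⇔ (to (adjacent i j) ∘ from E) (to E ∘ from (adjacent i j))
  }
  where open IsInducedCycleOn r

isCycle⇒isInducedCycle : {G : Graph n} (c : Fin (3 + k) → Fin n) →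
                         IsCycle G c → IsInducedCycle G (range c)
isCycle⇒isInducedCycle c r = _ , c , record
  { injective = injective
  ; image     = ∈-range c
  ; adjacent  = λ i j → let E = cycleAdj⇔adj↻ i j in
      mk⇔ (to (adjacent i j) ∘ to E) (from E ∘ from (adjacent i j))
  }
  where open IsCycle r

rotate : {G : Graph n} {S : Subset n} {c : Fin (3 + k) → Fin n} →
         IsInducedCycleOn G S c → IsInducedCycleOn G S (c ∘ pred↻)
rotate {G = G} {c = c} r = record
  { injective = pred↻-injective ∘ injective
  ; image     = λ x → mk⇔
      (λ x∈S → let (i , ci≡x) = to (image x) x∈S ; (j , eq) = pred↻-surjective i
               in j , trans (cong c eq) ci≡x)
      (λ (j , eq) → from (image x) (pred↻ j , eq))
  ; adjacent  = λ i j → mk⇔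
      (to (adjacent _ _) ∘ from (cycleAdj⇔adj↻ _ _) ∘
       Sum.map (cong pred↻) (cong pred↻) ∘ to (cycleAdj⇔adj↻ i j))
      (from (cycleAdj⇔adj↻ i j) ∘ Sum.map pred↻-injective pred↻-injective ∘
       to (cycleAdj⇔adj↻ _ _) ∘ from (adjacent _ _))
  }
  where open IsInducedCycleOn r

-- Each rotation moves `x` one position up, and from the last position to `zero`. The induction
-- therefore runs downwards from the last index.
rotateToStart : {G : Graph n} {S : Subset n} {x : Fin n} (i : Fin (3 + k)) →
                (c : Fin (3 + k) → Fin n) → IsInducedCycleOn G S c → c i ≡ x →
                ∃ λ (d : Fin (3 + k) → Fin n) → IsInducedCycleOn G S d × d zero ≡ x
rotateToStart {n} {k} {G} {S} {x} = >-weakInduction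
  (λ i → (c : Fin (3 + k) → Fin n) → IsInducedCycleOn G S c → c i ≡ x →
         ∃ λ (d : Fin (3 + k) → Fin n) → IsInducedCycleOn G S d × d zero ≡ x)
  (λ c r ci≡x → c ∘ pred↻ , rotate r , ci≡x)
  (λ i rec c r ci≡x → rec (c ∘ pred↻) (rotate r) ci≡x)

-- Induced paths, their extension and their closure to a cycle

record IsPath (G : Graph n) (p : Fin (suc k) → Fin n) : Set where
  field
    injective : Injective _≡_ _≡_ p
    adjacent  : ∀ i j → (suc i ≡ inject₁ j ⊎ suc j ≡ inject₁ i) ⇔ Adj G (p i) (p j)

∷-injective : {l : ℕ} {a : A} {p : Fin l → A} → (∀ i → p i ≢ a) → Injective _≡_ _≡_ p →
              Injective _≡_ _≡_ (a Vector.∷ p)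
∷-injective a∉p p-inj {zero}  {zero}  _  = refl
∷-injective a∉p p-inj {zero}  {suc j} eq = contradiction (sym eq) (a∉p j)
∷-injective a∉p p-inj {suc i} {zero}  eq = contradiction eq (a∉p i)
∷-injective a∉p p-inj {suc i} {suc j} eq = cong suc (p-inj eq)

-- Along the path nothing has to be checked again. `ends` says that the new vertex sees exactly the
-- two ends of the path, which are its neighbours in the cyclic order.
closePath : {G : Graph n} {a : Fin n} {p : Fin (2 + k) → Fin n} → IsPath G p → (∀ i → p i ≢ a) →
            (∀ i → (i ≡ zero ⊎ i ≡ fromℕ (suc k)) ⇔ Adj G a (p i)) →
            IsCycle G (a Vector.∷ p)
closePath {k = k} {G} {a} {p} path a∉p ends = record
  { injective = ∷-injective a∉p injective ; adjacent = adj }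
  where
  open IsPath path

  start : ∀ i → Adj↻ zero (suc i) ⇔ Adj G a (p i)
  start i = mk⇔
    (λ { (inj₁ eq) → to (ends i) (inj₁ (sym (inject₁-injective eq)))
       ; (inj₂ eq) → to (ends i) (inj₂ (suc-injective eq)) })
    (λ a~p → [ (λ { refl → inj₁ refl }) , (λ { refl → inj₂ refl }) ]′ (from (ends i) a~p))

  adj : ∀ i j → Adj↻ i j ⇔ Adj G ((a Vector.∷ p) i) ((a Vector.∷ p) j)
  adj zero    zero    = mk⇔ (λ { (inj₁ ()) ; (inj₂ ()) }) (λ a~a → contradiction a~a (adj-irrefl G))
  adj zero    (suc j) = start j
  adj (suc i) zero    = mk⇔ (adj-sym G ∘ to (start i) ∘ swap) (swap ∘ from (start i) ∘ adj-sym G)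
  adj (suc i) (suc j) = adjacent i j

∷-isPath : {G : Graph n} {a : Fin n} {p : Fin (suc k) → Fin n} → IsPath G p → (∀ i → p i ≢ a) →
           (∀ i → i ≡ zero ⇔ Adj G a (p i)) → IsPath G (a Vector.∷ p)
∷-isPath {G = G} {a} {p} path a∉p ends = record
  { injective = ∷-injective a∉p injective ; adjacent = adj }
  where
  open IsPath path

  adj : ∀ i j → (suc i ≡ inject₁ j ⊎ suc j ≡ inject₁ i) ⇔ Adj G ((a Vector.∷ p) i) ((a Vector.∷ p) j)
  adj zero    zero    = mk⇔ (λ { (inj₁ ()) ; (inj₂ ()) }) (λ a~a → contradiction a~a (adj-irrefl G))
  adj zero    (suc j) = mk⇔
    (λ { (inj₁ eq) → to (ends j) (sym (inject₁-injective (suc-injective eq))) ; (inj₂ ()) })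
    (λ a~p → inj₁ (cong (suc ∘ inject₁) (sym (from (ends j) a~p))))
  adj (suc i) zero    = mk⇔
    (λ { (inj₁ ()) ; (inj₂ eq) → adj-sym G (to (ends i) (sym (inject₁-injective (suc-injective eq)))) })
    (λ p~a → inj₂ (cong (suc ∘ inject₁) (sym (from (ends i) (adj-sym G p~a)))))
  adj (suc i) (suc j) = mk⇔
    (to (adjacent i j) ∘ Sum.map suc-injective suc-injective)
    (Sum.map (cong suc) (cong suc) ∘ from (adjacent i j))

-- Edges as pairs with the smaller endpoint first

ordered : Fin n → Fin n → Fin n × Fin n
ordered x y with x <? y
... | yes _ = x , y
... | no  _ = y , x

ordered-< : {x y : Fin n} → x Fin.< y → ordered x y ≡ (x , y)
ordered-< {x = x} {y} x<y with x <? y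
... | yes _  = refl
... | no x≮y = contradiction x<y x≮y

ordered-comm : {x y : Fin n} → x ≢ y → ordered x y ≡ ordered y x
ordered-comm {x = x} {y} x≢y with x <? y | y <? x
... | yes x<y | yes y<x = contradiction y<x (ℕ.<-asym x<y)
... | yes _   | no _    = refl
... | no _    | yes _   = refl
... | no x≮y  | no y≮x  = contradiction (toℕ-injective (ℕ.≤-antisym (ℕ.≮⇒≥ y≮x) (ℕ.≮⇒≥ x≮y))) x≢y

∈-edges⁺ : (G : Graph n) {x y : Fin n} → x Fin.< y → Adj G x y → (x , y) ∈ˡ edges G
∈-edges⁺ G x<y x~y = ∈-filter⁺ (λ (x , y) → (x <? y) ×-dec adj? G x y)
  (∈-cartesianProduct⁺ (∈-allFin _) (∈-allFin _)) (x<y , x~y)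

∈-edges⁻ : (G : Graph n) {x y : Fin n} → (x , y) ∈ˡ edges G → x Fin.< y × Adj G x y
∈-edges⁻ G = proj₂ ∘ ∈-filter⁻ (λ (x , y) → (x <? y) ×-dec adj? G x y)
  {xs = cartesianProduct (allFin _) (allFin _)}

-- Triangles as induced cycles

singleton-isPath : {G : Graph n} (x : Fin n) → IsPath G (x Vector.∷ Vector.[])
singleton-isPath {G = G} x = record
  { injective = λ { {zero} {zero} _ → refl }
  ; adjacent  = λ { zero zero → mk⇔ (λ { (inj₁ ()) ; (inj₂ ()) }) (λ x~x → contradiction x~x (adj-irrefl G)) }
  }

triangle : {G : Graph n} {x y z : Fin n} → Adj G x y → Adj G x z → Adj G y z →
           IsCycle G (x Vector.∷ y Vector.∷ z Vector.∷ Vector.[])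
triangle {G = G} x~y x~z y~z = closePath
  (∷-isPath (singleton-isPath _) (λ { zero → adj⇒≢ G y~z ∘ sym })
    (λ { zero → mk⇔ (λ _ → y~z) (λ _ → refl) }))
  (λ { zero → adj⇒≢ G x~y ∘ sym ; (suc zero) → adj⇒≢ G x~z ∘ sym })
  (λ { zero → mk⇔ (λ _ → x~y) (λ _ → inj₁ refl)
     ; (suc zero) → mk⇔ (λ _ → x~z) (λ _ → inj₂ refl) })

factorThroughSuc : {l : ℕ} (f : Fin l → Fin (suc n)) → (∀ i → f i ≢ zero) →
                   -- `suc` is `punchIn zero`, so `punchOut` at `zero` inverts it.
                   ∃ λ (g : Fin l → Fin n) → ∀ i → suc (g i) ≡ f i
factorThroughSuc f f≢0 = (λ i → punchOut (f≢0 i ∘ sym)) , λ i → punchIn-punchOut (f≢0 i ∘ sym)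

-- The contraction of a fixed edge and its map on vertices

module _ {m : ℕ} (G : Graph (suc (suc m))) {u v : Fin (suc (suc m))} (e : Adj G u v) where

  private
    u≢v : u ≢ v
    u≢v = adj⇒≢ G e

    old : Fin m → Fin (2 + m)
    old = others u≢v

    old-injective : Injective _≡_ _≡_ old
    old-injective = punchIn-injective _ _ _ ∘ punchIn-injective u _ _

    old≢u : ∀ i → old i ≢ u
    old≢u i = punchInᵢ≢i u _

    old≢v : ∀ i → old i ≢ v
    old≢v i eq = punchInᵢ≢i (punchOut u≢v) i
      (punchIn-injective u _ _ (trans eq (sym (punchIn-punchOut u≢v))))

  data Origin : Fin (2 + m) → Set where
    isU   : Origin u
    isV   : Origin v
    isOld : ∀ i → Origin (old i)

  origin : ∀ x → Origin x
  origin x with u ≟ x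
  ... | yes refl = isU
  ... | no u≢x with punchOut u≢v ≟ punchOut u≢x
  ...   | yes eq = subst Origin
    (trans (sym (punchIn-punchOut u≢v)) (trans (cong (punchIn u) eq) (punchIn-punchOut u≢x))) isV
  ...   | no v≢x = subst Origin
    (trans (cong (punchIn u) (punchIn-punchOut v≢x)) (punchIn-punchOut u≢x)) (isOld (punchOut v≢x))

  -- The graph of the quotient map, with the image as first argument. As a relation it is defined by
  -- cases on the image, without testing whether `x` is `u` or `v`.
  Over : Fin (1 + m) → Fin (2 + m) → Set
  Over zero    x = x ≡ u ⊎ x ≡ v
  Over (suc i) x = old i ≡ x

  over-unique : ∀ {y y′ x} → Over y x → Over y′ x → y ≡ y′
  over-unique {zero}  {zero}  _           _    = refl
  over-unique {zero}  {suc i} (inj₁ refl) eq   = contradiction eq (old≢u i)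
  over-unique {zero}  {suc i} (inj₂ refl) eq   = contradiction eq (old≢v i)
  over-unique {suc i} {zero}  eq (inj₁ refl)   = contradiction eq (old≢u i)
  over-unique {suc i} {zero}  eq (inj₂ refl)   = contradiction eq (old≢v i)
  over-unique {suc i} {suc j} eq eq′           = cong suc (old-injective (trans eq (sym eq′)))

  Contracts : Subset (2 + m) → Subset (1 + m) → Set
  Contracts S T = ∀ y → y ∈ T ⇔ ∃ λ x → x ∈ S × Over y x

  contracts-unique : ∀ {S T T′} → Contracts S T → Contracts S T′ → T ≡ T′
  contracts-unique S↦T S↦T′ = subset-ext λ y →
    mk⇔ (from (S↦T′ y) ∘ to (S↦T y)) (from (S↦T y) ∘ to (S↦T′ y))

  -- The lengths `l` and `l′` may differ: a lift that passes through both `u` and `v` has one vertex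
  -- more than the cycle below it.
  contracts-range : ∀ {T} {l l′ : ℕ} {c : Fin l → Fin (1 + m)} (d : Fin l′ → Fin (2 + m)) →
                    (∀ x → x ∈ T ⇔ ∃ λ i → c i ≡ x) →
                    (∀ i → ∃ λ j → Over (c i) (d j)) → (∀ j → ∃ λ i → Over (c i) (d j)) →
                    Contracts (range d) T
  contracts-range d image lift project y = mk⇔
    (λ y∈T → let (i , ci≡y) = to (image y) y∈T ; (j , over) = lift i in
      d j , from (∈-range d (d j)) (j , refl) , subst (λ z → Over z (d j)) ci≡y over)
    (λ (x , x∈d , y↤x) → let (j , dj≡x) = to (∈-range d x) x∈d ; (i , over) = project j in
      from (image y) (i , over-unique over (subst (Over y) (sym dj≡x) y↤x)))

  IsEdgeTriangle : Fin m → Subset (2 + m) → Set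
  IsEdgeTriangle i S = ∀ x → x ∈ S ⇔ (x ≡ u ⊎ x ≡ v ⊎ x ≡ old i)

  edgeTriangle-unique : ∀ {i j S} → IsEdgeTriangle i S → IsEdgeTriangle j S → i ≡ j
  edgeTriangle-unique {i} {j} tᵢ tⱼ with to (tⱼ (old i)) (from (tᵢ (old i)) (inj₂ (inj₂ refl)))
  ... | inj₁ eq        = contradiction eq (old≢u i)
  ... | inj₂ (inj₁ eq) = contradiction eq (old≢v i)
  ... | inj₂ (inj₂ eq) = old-injective eq

  -- Recorded for every lift, so that lifts and triangles on the edge can be counted together.
  NotEdgeTriangle : Subset (2 + m) → Set
  NotEdgeTriangle S = ∀ i → ¬ IsEdgeTriangle i S

  -- The two orientations of the edge e, so that each lift is built for one of them only.
  data Ends : Fin (2 + m) → Fin (2 + m) → Set where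
    uv : Ends u v
    vu : Ends v u

  module _ {a b : Fin (2 + m)} where

    ends-adj : Ends a b → Adj G a b
    ends-adj uv = e
    ends-adj vu = adj-sym G e

    ends-over : Ends a b → Over zero a × Over zero b
    ends-over uv = inj₁ refl , inj₂ refl
    ends-over vu = inj₂ refl , inj₁ refl

    old≢ends : Ends a b → ∀ i → old i ≢ a × old i ≢ b
    old≢ends uv i = old≢u i , old≢v i
    old≢ends vu i = old≢v i , old≢u i

    ends-adj⇒ : Ends a b → ∀ {x} → Adj G a x ⊎ Adj G b x → Adj G u x ⊎ Adj G v x
    ends-adj⇒ uv = id
    ends-adj⇒ vu = swap

    -- A triangle on the edge contains both of its ends, so missing one of them is enough.
    avoids⇒notEdgeTriangle : Ends a b → {l : ℕ} (d : Fin l → Fin (2 + m)) → (∀ j → d j ≢ b) →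
                             NotEdgeTriangle (range d)
    avoids⇒notEdgeTriangle ends d d≢b i t with to (∈-range d b) (from (t b) (b∈ ends))
      where
      b∈ : Ends a b → b ≡ u ⊎ b ≡ v ⊎ b ≡ old i
      b∈ uv = inj₂ (inj₁ refl)
      b∈ vu = inj₁ refl
    ... | j , dj≡b = d≢b j dj≡b

  -- Lifting induced cycles of the contracted graph

  LiftOf : Subset (1 + m) → Set
  LiftOf T = ∃ λ S → IsInducedCycle G S × Contracts S T × NotEdgeTriangle S

  module _ {T : Subset (1 + m)} where

    -- Between old vertices the adjacency of `G / e` is by definition that of `G`, so the same
    -- cycle, read in `G`, serves as its lift.
    lift-avoiding : {c : Fin (3 + k) → Fin (1 + m)} → IsInducedCycleOn (G / e) T c →
                    (∀ i → c i ≢ zero) → LiftOf T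
    lift-avoiding {c = c} r c≢0 with factorThroughSuc c c≢0
    ... | w , w≡ = range d
        , isCycle⇒isInducedCycle d (record
            { injective = λ {i} {j} eq → injective
                (trans (sym (w≡ i)) (trans (cong suc (old-injective eq)) (w≡ j)))
            ; adjacent = λ i j → subst₂ (λ x y → Adj↻ i j ⇔ Adj (G / e) x y)
                (sym (w≡ i)) (sym (w≡ j)) (adjacent i j) })
        , contracts-range d (IsInducedCycleOn.image r) (λ i → i , over i) (λ i → i , over i)
        , avoids⇒notEdgeTriangle uv d (old≢v ∘ w)
      where
      open IsCycle (isInducedCycleOn⇒isCycle r)
      d = old ∘ w

      over : ∀ i → Over (c i) (d i)
      over i = subst (λ y → Over y (d i)) (w≡ i) refl

    module _ {c : Fin (3 + k) → Fin (1 + m)} (r : IsInducedCycleOn (G / e) T c) (c₀≡0 : c zero ≡ zero)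
             (w : Fin (2 + k) → Fin m) (w≡ : ∀ i → suc (w i) ≡ c (suc i)) where

      open IsCycle (isInducedCycleOn⇒isCycle r)

      private
        last : Fin (2 + k)
        last = fromℕ (suc k)

        w-injective : Injective _≡_ _≡_ w
        w-injective {i} {j} eq = suc-injective (injective
          (trans (sym (w≡ i)) (trans (cong suc eq) (w≡ j))))

      -- The cycle starts at the merged vertex. Deleting that vertex leaves an induced path on old
      -- vertices, where `G / e` and `G` agree.
      path : IsPath G (old ∘ w)
      path = record
        { injective = w-injective ∘ old-injective
        ; adjacent  = λ i j → subst₂ (λ x y → Adj↻ (suc i) (suc j) ⇔ Adj (G / e) x y)
            (sym (w≡ i)) (sym (w≡ j)) (adjacent (suc i) (suc j))
        }

      -- The merged vertex has just the first and last vertex of the path as neighbours on the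
      -- cycle, and its adjacency in `G / e` means adjacency to `u` or `v`. In particular neither
      -- `u` nor `v` sees an inner vertex of the path.
      path-ends : ∀ i → (i ≡ zero ⊎ i ≡ last) ⇔ (Adj G u (old (w i)) ⊎ Adj G v (old (w i)))
      path-ends i = mk⇔ (to E ∘ ends⇒) (⇒ends ∘ from E)
        where
        E : Adj↻ zero (suc i) ⇔ Adj (G / e) zero (suc (w i))
        E = subst₂ (λ x y → Adj↻ zero (suc i) ⇔ Adj (G / e) x y) c₀≡0 (sym (w≡ i)) (adjacent zero (suc i))

        ends⇒ : i ≡ zero ⊎ i ≡ last → Adj↻ zero (suc i)
        ends⇒ (inj₁ refl) = inj₁ refl
        ends⇒ (inj₂ refl) = inj₂ refl

        ⇒ends : Adj↻ zero (suc i) → i ≡ zero ⊎ i ≡ last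
        ⇒ends (inj₁ eq) = inj₁ (sym (inject₁-injective eq))
        ⇒ends (inj₂ eq) = inj₂ (suc-injective eq)

      module _ {a b : Fin (2 + m)} (ends : Ends a b) where

        private
          over-suc : ∀ i → Over (c (suc i)) (old (w i))
          over-suc i = subst (λ y → Over y (old (w i))) (w≡ i) refl

          over-zero : ∀ {x} → Over zero x → Over (c zero) x
          over-zero {x} = subst (λ y → Over y x) (sym c₀≡0)

        -- Here `a` takes the place of the merged vertex, and `b` is left off the cycle.
        lift-through : Adj G a (old (w zero)) → Adj G a (old (w last)) → LiftOf T
        lift-through a~first a~last = range d
          , isCycle⇒isInducedCycle d (closePath path (proj₁ ∘ old≢ends ends ∘ w) λ i → mk⇔
              (λ { (inj₁ refl) → a~first ; (inj₂ refl) → a~last })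
              (from (path-ends i) ∘ ends-adj⇒ ends ∘ inj₁))
          , contracts-range d (IsInducedCycleOn.image r) (λ i → i , over i) (λ i → i , over i)
          , avoids⇒notEdgeTriangle ends d
              λ { zero → adj⇒≢ G (ends-adj ends) ; (suc i) → proj₂ (old≢ends ends (w i)) }
          where
          d = a Vector.∷ old ∘ w

          over : ∀ i → Over (c i) (d i)
          over zero    = over-zero (proj₁ (ends-over ends))
          over (suc i) = over-suc i

        -- The merged vertex is expanded into the edge: `a` precedes the path, seeing only its first
        -- vertex, and `b` closes the cycle, seeing only `a` and the last vertex.
        lift-across : Adj G a (old (w zero)) → ¬ Adj G a (old (w last)) →
                      Adj G b (old (w last)) → ¬ Adj G b (old (w zero)) → LiftOf T
        lift-across a~first a≁last b~last b≁first = range d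
          , isCycle⇒isInducedCycle d (closePath
              (∷-isPath path (proj₁ ∘ old≢ends ends ∘ w) λ i → mk⇔
                (λ { refl → a~first })
                (λ a~ → [ id , (λ { refl → contradiction a~ a≁last }) ]′
                  (from (path-ends i) (ends-adj⇒ ends (inj₁ a~)))))
              (λ { zero → adj⇒≢ G (ends-adj ends) ; (suc i) → proj₂ (old≢ends ends (w i)) })
              λ { zero → mk⇔ (λ _ → adj-sym G (ends-adj ends)) (λ _ → inj₁ refl)
                ; (suc i) → mk⇔
                    (λ { (inj₂ refl) → b~last })
                    (λ b~ → [ (λ { refl → contradiction b~ b≁first }) , inj₂ ∘ cong suc ]′
                      (from (path-ends i) (ends-adj⇒ ends (inj₂ b~)))) })
          , contracts-range d (IsInducedCycleOn.image r)
              -- Positions zero and one of `d` both lie over the merged vertex. Position zero is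
              -- chosen as the lift, and later positions shift by one.
              (λ { zero → zero , over-zero (proj₂ (ends-over ends)) ; (suc i) → suc (suc i) , over-suc i })
              (λ { zero → zero , over-zero (proj₂ (ends-over ends))
                 ; (suc zero) → zero , over-zero (proj₁ (ends-over ends))
                 ; (suc (suc i)) → suc i , over-suc i })
          -- In a triangle on the edge there is a single old vertex, but the path has distinct first
          -- and last vertices.
          , λ i t → contradiction (w-injective {zero} {last} (trans (hits t zero) (sym (hits t last)))) λ ()
          where
          d = b Vector.∷ a Vector.∷ old ∘ w

          hits : ∀ {i} → IsEdgeTriangle i (range d) → ∀ j → w j ≡ i
          hits t j with to (t (old (w j))) (from (∈-range d _) (suc (suc j) , refl))
          ... | inj₁ eq        = contradiction eq (old≢u (w j))
          ... | inj₂ (inj₁ eq) = contradiction eq (old≢v (w j))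
          ... | inj₂ (inj₂ eq) = old-injective eq

      lift-path : LiftOf T
      lift-path with adj? G u (old (w zero)) | adj? G u (old (w last))
                   | adj? G v (old (w zero)) | adj? G v (old (w last))
      ... | yes p | yes q | _     | _     = lift-through uv p q
      ... | _     | _     | yes p | yes q = lift-through vu p q
      ... | yes p | no q  | no q′ | yes p′ = lift-across uv p q p′ q′
      ... | no q  | yes p | yes p′ | no q′ = lift-across vu p′ q′ p q
      -- The cases left have an end of the path that sees neither `u` nor `v`, against `path-ends`.
      ... | no p  | _     | no q  | _     = contradiction (to (path-ends zero) (inj₁ refl)) [ p , q ]′
      ... | _     | no p  | _     | no q  = contradiction (to (path-ends last) (inj₂ refl)) [ p , q ]′

    liftCycle : IsInducedCycle (G / e) T → LiftOf T
    liftCycle (k , c , r) with any? (λ i → c i ≟ zero)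
    ... | no  c∌0        = lift-avoiding r λ i ci≡0 → c∌0 (i , ci≡0)
    ... | yes (i , ci≡0) with rotateToStart i c r ci≡0
    -- The merged vertex now sits at position zero, so by injectivity all other positions carry old
    -- vertices.
    ...   | d , s , d₀≡0 with factorThroughSuc (d ∘ suc) (λ i di≡0 →
              contradiction (IsInducedCycleOn.injective s (trans di≡0 (sym d₀≡0))) λ ())
    ...     | w , w≡ = lift-path s d₀≡0 w w≡

  -- Common neighbours and the bounds on cycles and edges

  private
    commonNeighbour? : (i : Fin m) → Dec (Adj G u (old i) × Adj G v (old i))
    commonNeighbour? i = adj? G u (old i) ×-dec adj? G v (old i)

  commonNeighbours : List (Fin m)
  commonNeighbours = filter commonNeighbour? (allFin m)

  commonNeighbours-unique : Unique commonNeighbours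
  commonNeighbours-unique = Unique.filter⁺ commonNeighbour? (Unique.allFin⁺ m)

  ∈-commonNeighbours⁺ : ∀ {i} → Adj G u (old i) → Adj G v (old i) → i ∈ˡ commonNeighbours
  ∈-commonNeighbours⁺ u~i v~i = ∈-filter⁺ commonNeighbour? (∈-allFin _) (u~i , v~i)

  ∈-commonNeighbours⁻ : ∀ {i} → i ∈ˡ commonNeighbours → Adj G u (old i) × Adj G v (old i)
  ∈-commonNeighbours⁻ i∈ = proj₂ (∈-filter⁻ commonNeighbour? {xs = allFin m} i∈)

  edgeTriangle : ∀ {i} → Adj G u (old i) × Adj G v (old i) →
                 ∃ λ S → IsInducedCycle G S × IsEdgeTriangle i S
  edgeTriangle {i} (u~i , v~i) = range d
    , isCycle⇒isInducedCycle d (triangle e u~i v~i)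
    , λ x → mk⇔ (members ∘ to (∈-range d x))
        λ { (inj₁ refl)        → from (∈-range d u) (zero , refl)
          ; (inj₂ (inj₁ refl)) → from (∈-range d v) (suc zero , refl)
          ; (inj₂ (inj₂ refl)) → from (∈-range d (old i)) (suc (suc zero) , refl) }
    where
    d = u Vector.∷ v Vector.∷ old i Vector.∷ Vector.[]

    members : ∀ {x} → (∃ λ j → d j ≡ x) → x ≡ u ⊎ x ≡ v ⊎ x ≡ old i
    members (zero , refl)           = inj₁ refl
    members (suc zero , refl)       = inj₂ (inj₁ refl)
    members (suc (suc zero) , refl) = inj₂ (inj₂ refl)

  -- A lift determines its cycle by contraction, and a triangle on the edge determines its third
  -- vertex. `NotEdgeTriangle` keeps the two families apart.
  cycles-bound : length (inducedCycles (G / e)) + length commonNeighbours ℕ.≤ length (inducedCycles G)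
  cycles-bound = disjointInjectiveRelations⇒length≤
    (inducedCycles-unique (G / e)) commonNeighbours-unique
    (λ T S → Contracts S T × NotEdgeTriangle S) IsEdgeTriangle
    (λ (p , _) (q , _) → contracts-unique p q)
    edgeTriangle-unique
    (λ (_ , S≢) isTriangle → S≢ _ isTriangle)
    (λ T∈ → let (S , cycle , lifts) = liftCycle (∈-inducedCycles⁻ (G / e) T∈)
            in S , ∈-inducedCycles⁺ G cycle , lifts)
    (λ i∈ → let (S , cycle , isTriangle) = edgeTriangle (∈-commonNeighbours⁻ i∈)
            in S , ∈-inducedCycles⁺ G cycle , isTriangle)

  -- Every edge of `G` occurs in one list: a representative for each edge of `G / e`, then `e`
  -- itself, then the edges from `v` to common neighbours, which the contraction merges with edges
  -- at `u`.
  edges-bound : length (edges G) ℕ.≤ length (edges (G / e)) + suc (length commonNeighbours)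
  edges-bound = subst (length (edges G) ℕ.≤_) length-targets (⊆⇒length≤ (edges-unique G) edges⊆targets)
    where
    -- Of two edges of G merged by the contraction, the one at u is the representative.
    representative : Fin (1 + m) × Fin (1 + m) → Fin (2 + m) × Fin (2 + m)
    representative (suc i , suc j) = ordered (old i) (old j)
    -- Default values: `edges` puts the smaller endpoint first, so `zero` is never a second entry.
    representative (suc i , zero)  = u , v
    representative (zero  , zero)  = u , v
    representative (zero  , suc j) with adj? G u (old j)
    ... | yes _ = ordered u (old j)
    ... | no  _ = ordered v (old j)

    kept  = List.map representative (edges (G / e))
    extra = List.map (ordered v ∘ old) commonNeighbours

    targets : List (Fin (2 + m) × Fin (2 + m))
    targets = kept ++ ordered u v ∷ extra

    length-targets : length targets ≡ length (edges (G / e)) + suc (length commonNeighbours)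
    length-targets = length-map-++-∷-map representative (ordered u v) (ordered v ∘ old)
      (edges (G / e)) commonNeighbours

    ∈-kept : ∀ {x y} → x Fin.< y → Adj (G / e) x y → representative (x , y) ∈ˡ targets
    ∈-kept x<y x~y = ∈-++⁺ˡ (∈-map⁺ representative (∈-edges⁺ (G / e) x<y x~y))

    u-old : ∀ i → Adj G u (old i) → ordered u (old i) ∈ˡ targets
    u-old i u~i with adj? G u (old i) | ∈-kept {zero} {suc i} ℕ.z<s (inj₁ u~i)
    ... | yes _  | p = p
    ... | no u≁i | _ = contradiction u~i u≁i

    -- If `u` sees the same vertex, the representative is the edge at `u` and this one is found in
    -- `extra`. Otherwise it is itself the representative.
    v-old : ∀ i → Adj G v (old i) → ordered v (old i) ∈ˡ targets
    v-old i v~i with adj? G u (old i) | ∈-kept {zero} {suc i} ℕ.z<s (inj₂ v~i)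
    ... | yes u~i | _ = ∈-++⁺ʳ kept (there (∈-map⁺ (ordered v ∘ old) (∈-commonNeighbours⁺ u~i v~i)))
    ... | no _    | p = p

    old-old : ∀ i j → Adj G (old i) (old j) → ordered (old i) (old j) ∈ˡ targets
    old-old i j i~j with <-cmp i j
    ... | tri< i<j _ _  = ∈-kept (s≤s i<j) i~j
    ... | tri≈ _ refl _ = contradiction i~j (adj-irrefl G)
    ... | tri> _ _ j<i  = subst (_∈ˡ targets) (ordered-comm (adj⇒≢ G (adj-sym G i~j)))
      (∈-kept (s≤s j<i) (adj-sym G i~j))

    ordered∈targets : ∀ {x y} → Adj G x y → ordered x y ∈ˡ targets
    ordered∈targets {x} {y} x~y with origin x | origin y
    ... | isU     | isU     = contradiction x~y (adj-irrefl G)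
    ... | isU     | isV     = ∈-++⁺ʳ kept (here refl)
    ... | isU     | isOld j = u-old j x~y
    ... | isV     | isU     = ∈-++⁺ʳ kept (here (ordered-comm (adj⇒≢ G x~y)))
    ... | isV     | isV     = contradiction x~y (adj-irrefl G)
    ... | isV     | isOld j = v-old j x~y
    ... | isOld i | isU     = subst (_∈ˡ targets) (ordered-comm (old≢u i ∘ sym)) (u-old i (adj-sym G x~y))
    ... | isOld i | isV     = subst (_∈ˡ targets) (ordered-comm (old≢v i ∘ sym)) (v-old i (adj-sym G x~y))
    ... | isOld i | isOld j = old-old i j x~y

    edges⊆targets : ∀ {p} → p ∈ˡ edges G → p ∈ˡ targets
    edges⊆targets p∈ with ∈-edges⁻ G p∈
    ... | x<y , x~y = subst (_∈ˡ targets) (ordered-< x<y) (ordered∈targets x~y)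

-- Combining the two bounds

ℶ²-mono : ∀ {n n′} (G : Graph n) (G′ : Graph n′) → n ≡ suc n′ → ∀ t →
          length (inducedCycles G′) + t ℕ.≤ length (inducedCycles G) →
          length (edges G) ℕ.≤ length (edges G′) + suc t →
          ℶ² G′ ≤ ℶ² G
ℶ²-mono {n′ = n′} G G′ refl t c′+t≤c e≤e′+1+t =
  -- Adding `n′ - e - e′` to both sides of `bound` gives the two characteristics. The lost vertex
  -- accounts for the 1 in `suc e′`.
  subst₂ _≤_ (lhs (ℤ.+ c′) (ℤ.+ e) (ℤ.+ e′) (ℤ.+ n′)) (rhs (ℤ.+ c) (ℤ.+ e) (ℤ.+ e′) (ℤ.+ n′))
    (ℤ.+-monoˡ-≤ (ℤ.- ℤ.+ e ℤ.- ℤ.+ e′ ℤ.+ ℤ.+ n′) (ℤ.+≤+ bound))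
  where
  c  = length (inducedCycles G)
  c′ = length (inducedCycles G′)
  e  = length (edges G)
  e′ = length (edges G′)

  lhs : ∀ C′ E E′ N → C′ ℤ.+ E ℤ.+ (ℤ.- E ℤ.- E′ ℤ.+ N) ≡ C′ ℤ.- E′ ℤ.+ N
  lhs = solve-∀

  rhs : ∀ C E E′ N → C ℤ.+ (ℤ.1ℤ ℤ.+ E′) ℤ.+ (ℤ.- E ℤ.- E′ ℤ.+ N) ≡ C ℤ.- E ℤ.+ (ℤ.1ℤ ℤ.+ N)
  rhs = solve-∀

  -- The `t` extra cycles of `G` pay for `t` of the at most `suc t` lost edges.
  bound : c′ + e ℕ.≤ c + suc e′
  bound = begin
    c′ + e            ≤⟨ ℕ.+-monoʳ-≤ c′ e≤e′+1+t ⟩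
    c′ + (e′ + suc t) ≡⟨ cong (c′ +_) (trans (ℕ.+-suc e′ t) (ℕ.+-comm (suc e′) t)) ⟩
    c′ + (t + suc e′) ≡⟨ ℕ.+-assoc c′ t (suc e′) ⟨
    c′ + t + suc e′   ≤⟨ ℕ.+-monoˡ-≤ (suc e′) c′+t≤c ⟩
    c + suc e′        ∎
    where open ℕ.≤-Reasoning

theorem3p1p1 : ∀ {n : ℕ} (G : Graph n) → Connected G →
    ∀ {u v : Fin n} (e : Adj G u v) → ℶ² (G / e) ≤ ℶ² G
theorem3p1p1 {suc zero}    G _ {zero} {zero} e = contradiction e (adj-irrefl G)
-- The order of G / e is written as in the type of _/_ : given another form of it, Agda would
-- compare the two sides by evaluating ℶ².
theorem3p1p1 {suc (suc n)} G _ e =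
  ℶ²-mono {n′ = ℕ.pred (suc (suc n))} G (G / e) refl (length (commonNeighbours G e))
    (cycles-bound G e) (edges-bound G e)
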